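{- For integers $N\ge 1$ and $n\ge 1$, $$B_{N,n}=(-1)^n\,n!\,\det\big(c_{ij}\big)_{1\le i,j\le n},$$ where $c_{ij}=\dfrac{N!}{(N+i-j+1)!}$ if $j\le i$, $c_{ij}=1$ if $j=i+1$, and $c_{ij}=0$ if $j>i+1$. That is, the matrix has $\frac{N!}{(N+1)!}$ on the diagonal, $1$ on the superdiagonal, zeros above the superdiagonal, and $\frac{N!}{(N+k+1)!}$ on the $k$-th subdiagonal.
   Context: For a positive integer $N$, the hypergeometric Bernoulli numbers $B_{N,n}$ ($n\ge 0$) are defined by $$\frac{x^N/N!}{e^x-\sum_{n=0}^{N-1}x^n/n!}=\sum_{n=0}^\infty B_{N,n}\frac{x^n}{n!}.$$ -}

module Defs where

open import Algebra.Bundles using (CommutativeRing)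
import Algebra.Definitions.RawSemiring as RawSemiringDefs
import Algebra.Properties.Monoid.Sum as MonoidSum
open import Data.Bool.Base using (T; if_then_else_; true; false)
open import Data.Empty using (⊥-elim)
open import Data.Fin.Base as Fin using (Fin; toℕ; inject₁; fromℕ)
open import Data.Fin.Properties using (toℕ-inject₁; toℕ-fromℕ; toℕ<n)
open import Data.Integer.Base using (+_)
open import Data.Nat.Base as ℕ using (ℕ; zero; suc; _∸_; _≡ᵇ_; _≤ᵇ_; _!)
import Data.Nat.Properties as ℕₚ
open import Data.Nat.Properties using (_!≢0)
open import Data.Product.Base using (∃; _×_; _,_)
open import Data.Rational.Base using (ℚ; 0ℚ; 1ℚ; _+_; _*_; _-_; -_; _/_; 1/_; NonZero; +-*-rawSemiring)
import Data.Rational.Base as ℚ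
import Data.Rational.Properties as ℚₚ
open import Data.Vec.Functional using (removeAt)
open import Function.Base using (_∘_)
open import Relation.Binary.PropositionalEquality

open RawSemiringDefs +-*-rawSemiring public using (_^_; sum)

fromℕℚ : ℕ → ℚ
fromℕℚ n = + n / 1

invFact : ℕ → ℚ
invFact n = (+ 1 / (n !)) {{n !≢0}}

-- Formal power series over ℚ: f n is the coefficient of xⁿ.
Series : Set
Series = ℕ → ℚ

monomial : ℚ → ℕ → Series
monomial c k n = if n ≡ᵇ k then c else 0ℚ

infixl 6 _⊖_
infixl 7 _⊛_

_⊖_ : Series → Series → Series
(f ⊖ g) n = f n - g n

-- Cauchy product.
_⊛_ : Series → Series → Series
(f ⊛ g) n = sum {suc n} λ k → f (toℕ k) * g (n ∸ toℕ k)

exp : Series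
exp n = invFact n

-- ∑_{i < N} xⁱ / i!
expPartial : ℕ → Series
expPartial N n = sum {N} λ i → monomial (invFact (toℕ i)) (toℕ i) n

-- ∑_{n ≥ 0} bₙ xⁿ / n!
egf : (ℕ → ℚ) → Series
egf b n = b n * invFact n

-- For N ≥ 1 the denominator eˣ - ∑_{i<N} xⁱ/i! is nonzero but not invertible
-- in ℚ[[x]], so the quotient is specified as the series whose product with the
-- denominator is xᴺ/N!.  By `hypergeometricBernoulli-exists` and
-- `hypergeometricBernoulli-unique` below, exactly one sequence satisfies this.
IsHypergeometricBernoulli : ℕ → (ℕ → ℚ) → Set
IsHypergeometricBernoulli N b =
  egf b ⊛ (exp ⊖ expPartial N) ≗ monomial (invFact N) N

Matrix : ℕ → Set
Matrix n = Fin n → Fin n → ℚ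

-- Laplace expansion along the first row; the determinant of the empty matrix is 1.
det : ∀ {n} → Matrix n → ℚ
det {zero}  A = 1ℚ
det {suc n} A = sum λ j →
  (- 1ℚ) ^ toℕ j * A Fin.zero j * det λ i → removeAt (A (Fin.suc i)) j

-- Indices i, j start at 1.  The truncated subtraction is exact, as j ≤ i.
c : ℕ → ℕ → ℕ → ℚ
c N i j =
  if j ≤ᵇ i then (+ (N !) / ((N ℕ.+ i ∸ j ℕ.+ 1) !)) {{(N ℕ.+ i ∸ j ℕ.+ 1) !≢0}}
  else if j ≡ᵇ i ℕ.+ 1 then 1ℚ
  else 0ℚ

cMatrix : ℕ → ∀ n → Matrix n
cMatrix N n i j = c N (suc (toℕ i)) (suc (toℕ j))

-- Existence and uniqueness, by long division of power series.

open MonoidSum (CommutativeRing.+-monoid ℚₚ.+-*-commutativeRing)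
  using (sum-cong-≗; sum-init-last; sum-replicate-zero)
open ≡-Reasoning

module SeriesDivision where

  cancel : ∀ a b → a + (b - a) ≡ b
  cancel a b = begin
    a + (b - a)   ≡⟨ cong (_+_ a) (ℚₚ.+-comm b (- a)) ⟩
    a + (- a + b) ≡⟨ ℚₚ.+-assoc a (- a) b ⟨
    a - a + b     ≡⟨ cong (_+ b) (ℚₚ.+-inverseʳ a) ⟩
    0ℚ + b        ≡⟨ ℚₚ.+-identityˡ b ⟩
    b             ∎

  cancel′ : ∀ {a b t} → a + b ≡ t → b ≡ t - a
  cancel′ {a} {b} refl = begin
    b             ≡⟨ ℚₚ.+-identityʳ b ⟨
    b + 0ℚ        ≡⟨ cong (_+_ b) (ℚₚ.+-inverseʳ a) ⟨
    b + (a - a)   ≡⟨ ℚₚ.+-assoc b a (- a) ⟨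
    b + a - a     ≡⟨ cong (_- a) (ℚₚ.+-comm b a) ⟩
    a + b - a     ∎

  module Division (e : Series) (u : ℚ) (e₀u≡1 : e 0 * u ≡ 1ℚ) where

    quotient : Series → Series
    quotient t zero    = u * t 0
    quotient t (suc n) = quotient (λ k → t (suc k) - u * t 0 * e (suc k)) n

    quotient-⊛ : ∀ t → quotient t ⊛ e ≗ t
    quotient-⊛ t zero = begin
      u * t 0 * e 0 + 0ℚ ≡⟨ ℚₚ.+-identityʳ _ ⟩
      u * t 0 * e 0      ≡⟨ ℚₚ.*-comm (u * t 0) (e 0) ⟩
      e 0 * (u * t 0)    ≡⟨ ℚₚ.*-assoc (e 0) u (t 0) ⟨
      e 0 * u * t 0      ≡⟨ cong (_* t 0) e₀u≡1 ⟩
      1ℚ * t 0           ≡⟨ ℚₚ.*-identityˡ (t 0) ⟩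
      t 0                ∎
    quotient-⊛ t (suc n) =
      trans (cong (_+_ (u * t 0 * e (suc n))) (quotient-⊛ t′ n)) (cancel (u * t 0 * e (suc n)) (t (suc n)))
      where
      t′ : Series
      t′ k = t (suc k) - u * t 0 * e (suc k)

    quotient-unique : ∀ s t → s ⊛ e ≗ t → s ≗ quotient t
    quotient-unique s t eq zero = begin
      s 0                    ≡⟨ ℚₚ.*-identityʳ (s 0) ⟨
      s 0 * 1ℚ               ≡⟨ cong (s 0 *_) e₀u≡1 ⟨
      s 0 * (e 0 * u)        ≡⟨ ℚₚ.*-assoc (s 0) (e 0) u ⟨
      s 0 * e 0 * u          ≡⟨ cong (_* u) (ℚₚ.+-identityʳ (s 0 * e 0)) ⟨
      (s 0 * e 0 + 0ℚ) * u   ≡⟨ cong (_* u) (eq 0) ⟩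
      t 0 * u                ≡⟨ ℚₚ.*-comm (t 0) u ⟩
      u * t 0                ∎
    quotient-unique s t eq (suc n) = quotient-unique (s ∘ suc) _ tail n
      where
      tail : (s ∘ suc) ⊛ e ≗ λ k → t (suc k) - u * t 0 * e (suc k)
      tail k = trans (cancel′ (eq (suc k)))
        (cong (λ z → t (suc k) - z * e (suc k)) (quotient-unique s t eq 0))

  ⊛-shift : ∀ s d → d 0 ≡ 0ℚ → ∀ n → (s ⊛ d) (suc n) ≡ (s ⊛ (d ∘ suc)) n
  ⊛-shift s d d₀≡0 n = begin
    (s ⊛ d) (suc n)
      ≡⟨ sum-init-last {suc n} (λ k → s (toℕ k) * d (suc n ∸ toℕ k)) ⟩
    sum {suc n} (λ k → s (toℕ (inject₁ k)) * d (suc n ∸ toℕ (inject₁ k))) + last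
      ≡⟨ cong₂ _+_ (sum-cong-≗ {suc n} init≡) last≡0 ⟩
    (s ⊛ (d ∘ suc)) n + 0ℚ
      ≡⟨ ℚₚ.+-identityʳ _ ⟩
    (s ⊛ (d ∘ suc)) n ∎
    where
    last : ℚ
    last = s (toℕ (fromℕ (suc n))) * d (suc n ∸ toℕ (fromℕ (suc n)))

    last≡0 : last ≡ 0ℚ
    last≡0 = begin
      last                ≡⟨ cong (λ m → s m * d (suc n ∸ m)) (toℕ-fromℕ (suc n)) ⟩
      s (suc n) * d (n ∸ n) ≡⟨ cong (λ m → s (suc n) * d m) (ℕₚ.n∸n≡0 n) ⟩
      s (suc n) * d 0     ≡⟨ cong (s (suc n) *_) d₀≡0 ⟩
      s (suc n) * 0ℚ      ≡⟨ ℚₚ.*-zeroʳ (s (suc n)) ⟩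
      0ℚ                  ∎

    init≡ : ∀ k → s (toℕ (inject₁ k)) * d (suc n ∸ toℕ (inject₁ k))
                ≡ s (toℕ k) * d (suc (n ∸ toℕ k))
    init≡ k = begin
      s (toℕ (inject₁ k)) * d (suc n ∸ toℕ (inject₁ k))
        ≡⟨ cong (λ m → s m * d (suc n ∸ m)) (toℕ-inject₁ k) ⟩
      s (toℕ k) * d (suc n ∸ toℕ k)
        ≡⟨ cong (λ m → s (toℕ k) * d m) (ℕₚ.+-∸-assoc 1 (ℕ.s≤s⁻¹ (toℕ<n k))) ⟩
      s (toℕ k) * d (suc (n ∸ toℕ k)) ∎

  ⊛-zero : ∀ s d → d 0 ≡ 0ℚ → (s ⊛ d) 0 ≡ 0ℚ
  ⊛-zero s d d₀≡0 = trans (ℚₚ.+-identityʳ _) (trans (cong (s 0 *_) d₀≡0) (ℚₚ.*-zeroʳ (s 0)))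

  divide : ∀ N d t u →
           (∀ {n} → n ℕ.< N → d n ≡ 0ℚ) → (∀ {n} → n ℕ.< N → t n ≡ 0ℚ) → d N * u ≡ 1ℚ →
           ∃ λ q → q ⊛ d ≗ t × (∀ s → s ⊛ d ≗ t → s ≗ q)
  divide zero    d t u _ _ du≡1 = quotient t , quotient-⊛ t , λ s → quotient-unique s t
    where open Division d u du≡1
  divide (suc N) d t u d≡0 t≡0 du≡1
    with q , q⊛d≗t , unique ← divide N (d ∘ suc) (t ∘ suc) u (d≡0 ∘ ℕ.s≤s) (t≡0 ∘ ℕ.s≤s) du≡1
    = q
    , (λ { zero    → trans (⊛-zero q d (d≡0 ℕ.z<s)) (sym (t≡0 ℕ.z<s))
         ; (suc n) → trans (⊛-shift q d (d≡0 ℕ.z<s) n) (q⊛d≗t n) })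
    , λ s eq → unique s λ n → trans (sym (⊛-shift s d (d≡0 ℕ.z<s) n)) (eq (suc n))

  monomial-≡ : ∀ a n → monomial a n n ≡ a
  monomial-≡ a zero    = refl
  monomial-≡ a (suc n) = monomial-≡ a n

  monomial-≢ : ∀ a {k n} → n ≢ k → monomial a k n ≡ 0ℚ
  monomial-≢ a {k} {n} n≢k with n ≡ᵇ k in eq
  ... | false = refl
  ... | true  = ⊥-elim (n≢k (ℕₚ.≡ᵇ⇒≡ n k (subst (λ b → T b) (sym eq) _)))

  monomials : (ℕ → ℚ) → ℕ → Series
  monomials a N n = sum {N} λ i → monomial (a (toℕ i)) (toℕ i) n

  monomials-< : ∀ a {N n} → n ℕ.< N → monomials a N n ≡ a n
  monomials-< a {suc N} {zero}  _ = begin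
    a 0 + sum {N} (λ _ → 0ℚ) ≡⟨ cong (_+_ (a 0)) (sum-replicate-zero N) ⟩
    a 0 + 0ℚ                 ≡⟨ ℚₚ.+-identityʳ (a 0) ⟩
    a 0                      ∎
  monomials-< a {suc N} {suc n} (ℕ.s≤s n<N) =
    trans (ℚₚ.+-identityˡ _) (monomials-< (a ∘ suc) n<N)

  monomials-≥ : ∀ a N {n} → N ℕ.≤ n → monomials a N n ≡ 0ℚ
  monomials-≥ a N {n} N≤n = trans
    (sum-cong-≗ {N} λ i → monomial-≢ (a (toℕ i)) (ℕₚ.>⇒≢ (ℕₚ.<-≤-trans (toℕ<n i) N≤n)))
    (sum-replicate-zero N)

  invFact-nonZero : ∀ n → NonZero (invFact n)
  invFact-nonZero n = ℚ.>-nonZero {invFact n} (ℚₚ.positive⁻¹ (invFact n) {{pos}})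
    where pos = ℚₚ.normalize-pos 1 (n !) {{n !≢0}}

  denominator-N : ∀ N → (exp ⊖ expPartial N) N ≡ invFact N
  denominator-N N = trans (cong (λ z → invFact N - z) (monomials-≥ invFact N ℕₚ.≤-refl)) (ℚₚ.+-identityʳ (invFact N))

  division : ∀ N → ∃ λ q → q ⊛ (exp ⊖ expPartial N) ≗ monomial (invFact N) N
                         × (∀ s → s ⊛ (exp ⊖ expPartial N) ≗ monomial (invFact N) N → s ≗ q)
  division N = divide N (exp ⊖ expPartial N) (monomial (invFact N) N) (1/_ (invFact N) {{nz}})
    (λ {n} n<N → trans (cong (λ z → invFact n - z) (monomials-< invFact n<N)) (ℚₚ.+-inverseʳ (invFact n)))
    (λ n<N → monomial-≢ (invFact N) (ℕₚ.<⇒≢ n<N))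
    (trans (cong (λ z → z * 1/_ (invFact N) {{nz}}) (denominator-N N)) (ℚₚ.*-inverseʳ (invFact N) {{nz}}))
    where nz = invFact-nonZero N

  *-cancel-invFact : ∀ n p → p * (1/_ (invFact n) {{invFact-nonZero n}}) * invFact n ≡ p
  *-cancel-invFact n p = begin
    p * w * invFact n   ≡⟨ ℚₚ.*-assoc p w (invFact n) ⟩
    p * (w * invFact n) ≡⟨ cong (p *_) (ℚₚ.*-inverseˡ (invFact n) {{invFact-nonZero n}}) ⟩
    p * 1ℚ           ≡⟨ ℚₚ.*-identityʳ p ⟩
    p                ∎
    where w = 1/_ (invFact n) {{invFact-nonZero n}}

  egf-injective : ∀ b b′ → egf b ≗ egf b′ → b ≗ b′
  egf-injective b b′ eq n = begin
    b n                ≡⟨ undo (b n) ⟨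
    egf b n * w        ≡⟨ cong (_* w) (eq n) ⟩
    egf b′ n * w       ≡⟨ undo (b′ n) ⟩
    b′ n               ∎
    where
    w = 1/_ (invFact n) {{invFact-nonZero n}}
    undo : ∀ p → p * invFact n * w ≡ p
    undo p = trans (ℚₚ.*-assoc p (invFact n) w)
      (trans (cong (p *_) (ℚₚ.*-inverseʳ (invFact n) {{invFact-nonZero n}})) (ℚₚ.*-identityʳ p))

open SeriesDivision

hypergeometricBernoulli-exists : ∀ N → ∃ (IsHypergeometricBernoulli N)
hypergeometricBernoulli-exists N with q , eq , _ ← division N
  = (λ n → q n * 1/_ (invFact n) {{invFact-nonZero n}})
  , λ n → trans
      (sum-cong-≗ {suc n} λ k → cong (_* (exp ⊖ expPartial N) (n ∸ toℕ k))
        (*-cancel-invFact (toℕ k) (q (toℕ k))))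
      (eq n)

hypergeometricBernoulli-unique :
  ∀ N {b b′} → IsHypergeometricBernoulli N b → IsHypergeometricBernoulli N b′ → b ≗ b′
hypergeometricBernoulli-unique N {b} {b′} h h′ with _ , _ , unique ← division N
  = egf-injective b b′ λ n → trans (unique (egf b) h n) (sym (unique (egf b′) h′ n))

{-# OPTIONS --safe #-}

-- Put e k = N! / (N + k)!, so that the denominator of the generating function
-- is xᴺ/N! · ∑ e k xᵏ, and let D n be the determinant of size n.  Expanding along
-- first rows (1 on the superdiagonal, 0 beyond it) gives
-- D (n + 1) = ∑_{k ≤ n} (-1)ᵏ e (k + 1) D (n - k), which says that the series
-- ∑ (-1)ⁿ D n xⁿ is the inverse of ∑ e k xᵏ.  Hence (-1)ⁿ n! D n satisfies the
-- equation defining B_{N,n}, and that equation has only one solution.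

module Submission where

open import Defs
open import Algebra.Bundles using (CommutativeRing)
import Algebra.Properties.CommutativeMonoid.Sum as CommutativeMonoidSum
import Algebra.Properties.Semiring.Sum as SemiringSum
open import Data.Bool.Base using (if_then_else_)
open import Data.Fin.Base using (Fin; zero; suc; toℕ; opposite; punchIn)
open import Data.Fin.Permutation using (reverse)
open import Data.Fin.Properties using (toℕ<n; opposite-prop)
open import Data.Integer.Base as ℤ using (+_)
import Data.Integer.Properties as ℤₚ
open import Data.Nat.Base using (ℕ; zero; suc; _≤_; _<_; _!; z<s; s≤s; s≤s⁻¹; _∸_; _≤ᵇ_; _≡ᵇ_)
import Data.Nat.Base as ℕ
import Data.Nat.Properties as ℕₚ
open import Data.Nat.Properties using (_!≢0)
open import Data.Rational.Base using (ℚ; 0ℚ; 1ℚ; _+_; _*_; _-_; -_; _/_; fromℚᵘ; toℚᵘ)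
import Data.Rational.Properties as ℚₚ
open import Data.Rational.Solver using (module +-*-Solver)
open import Data.Rational.Unnormalised.Base as ℚᵘ using (mkℚᵘ; *≡*)
import Data.Rational.Unnormalised.Properties as ℚᵘₚ
open import Data.Vec.Functional using (removeAt)
open import Function.Base using (_∘_)
open import Relation.Binary.PropositionalEquality

open CommutativeMonoidSum (CommutativeRing.+-commutativeMonoid ℚₚ.+-*-commutativeRing)
  using (sum-cong-≗; sum-replicate-zero; sum-permute)
open SemiringSum (CommutativeRing.semiring ℚₚ.+-*-commutativeRing)
  using (*-distribˡ-sum)
open +-*-Solver using (solve; _:+_; _:*_; :-_; _:=_; con)
open SeriesDivision using (⊛-shift; ⊛-zero; monomial-≢; monomials-<; monomials-≥)
open ≡-Reasoning

-- Fractions and factorials in `ℚ`.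

fromℚᵘ-homo-* : ∀ p q → fromℚᵘ p * fromℚᵘ q ≡ fromℚᵘ (p ℚᵘ.* q)
fromℚᵘ-homo-* p q = begin
  fromℚᵘ p * fromℚᵘ q
    ≡⟨ ℚₚ.fromℚᵘ-toℚᵘ _ ⟨
  fromℚᵘ (toℚᵘ (fromℚᵘ p * fromℚᵘ q))
    ≡⟨ ℚₚ.fromℚᵘ-cong (ℚₚ.toℚᵘ-homo-* (fromℚᵘ p) (fromℚᵘ q)) ⟩
  fromℚᵘ (toℚᵘ (fromℚᵘ p) ℚᵘ.* toℚᵘ (fromℚᵘ q))
    ≡⟨ ℚₚ.fromℚᵘ-cong (ℚᵘₚ.*-cong (ℚₚ.toℚᵘ-fromℚᵘ p) (ℚₚ.toℚᵘ-fromℚᵘ q)) ⟩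
  fromℚᵘ (p ℚᵘ.* q) ∎

-- Reduction to lowest terms blocks computation in `ℚ`; for unnormalised fractions the claim is a
-- cross multiplication of integers.
/≡*-1/ : ∀ a b .{{_ : ℕ.NonZero b}} → + a / b ≡ fromℕℚ a * (+ 1 / b)
/≡*-1/ a b@(suc b-1) = sym (trans
  (fromℚᵘ-homo-* (mkℚᵘ (+ a) 0) (mkℚᵘ (+ 1) b-1))
  (ℚₚ.fromℚᵘ-cong {mkℚᵘ (+ a) 0 ℚᵘ.* mkℚᵘ (+ 1) b-1} {mkℚᵘ (+ a) b-1}
    (*≡* (cong₂ ℤ._*_ (ℤₚ.*-identityʳ (+ a)) (sym (ℤₚ.*-identityˡ (+ b)))))))


n/n≡1 : ∀ n .{{_ : ℕ.NonZero n}} → + n / n ≡ 1ℚ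
n/n≡1 n@(suc n-1) = ℚₚ.fromℚᵘ-cong {mkℚᵘ (+ n) n-1} {mkℚᵘ (+ 1) 0} (*≡* (ℤₚ.*-comm (+ n) (+ 1)))

!*invFact≡1 : ∀ n → fromℕℚ (n !) * invFact n ≡ 1ℚ
!*invFact≡1 n = trans (sym (/≡*-1/ (n !) (n !) {{n !≢0}})) (n/n≡1 (n !) {{n !≢0}})

-- Algebra of the Cauchy product.

⊛-cong : ∀ {f f′ g g′} → f ≗ f′ → g ≗ g′ → f ⊛ g ≗ f′ ⊛ g′
⊛-cong f≗f′ g≗g′ n =
  sum-cong-≗ {suc n} λ k → cong₂ _*_ (f≗f′ (toℕ k)) (g≗g′ (n ∸ toℕ k))

-- Reindexing by `k ↦ n ∸ k`, which on `Fin (suc n)` is `opposite`, swaps the two factors of each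
-- term.
⊛-comm : ∀ f g → f ⊛ g ≗ g ⊛ f
⊛-comm f g n = trans
  (sum-permute {suc n} (λ k → f (toℕ k) * g (n ∸ toℕ k)) reverse)
  (sum-cong-≗ {suc n} swapped)
  where
  swapped : ∀ k → f (toℕ (opposite k)) * g (n ∸ toℕ (opposite k)) ≡ g (toℕ k) * f (n ∸ toℕ k)
  swapped k = begin
    f (toℕ (opposite k)) * g (n ∸ toℕ (opposite k))
      ≡⟨ cong (λ m → f m * g (n ∸ m)) (opposite-prop k) ⟩
    f (n ∸ toℕ k) * g (n ∸ (n ∸ toℕ k))
      ≡⟨ cong (λ m → f (n ∸ toℕ k) * g m) (ℕₚ.m∸[m∸n]≡n (s≤s⁻¹ (toℕ<n k))) ⟩
    f (n ∸ toℕ k) * g (toℕ k)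
      ≡⟨ ℚₚ.*-comm (f (n ∸ toℕ k)) (g (toℕ k)) ⟩
    g (toℕ k) * f (n ∸ toℕ k) ∎

⊛-scaleʳ : ∀ a f g n → (f ⊛ λ k → a * g k) n ≡ a * (f ⊛ g) n
⊛-scaleʳ a f g n = trans
  (sum-cong-≗ {suc n} λ k →
    solve 3 (λ x y z → x :* (y :* z) := y :* (x :* z)) refl (f (toℕ k)) a (g (n ∸ toℕ k)))
  (sym (*-distribˡ-sum {suc n} a (λ k → f (toℕ k) * g (n ∸ toℕ k))))

-- A common factor `xᴺ` of `d` and `t` may be divided out; the induction removes one factor `x` at a
-- time.
⊛-delay : ∀ N s d t → (∀ {n} → n < N → d n ≡ 0ℚ) → (∀ {n} → n < N → t n ≡ 0ℚ) →
          s ⊛ (d ∘ (N ℕ.+_)) ≗ t ∘ (N ℕ.+_) → s ⊛ d ≗ t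
⊛-delay zero    s d t d≡0 t≡0 eq n       = eq n
⊛-delay (suc N) s d t d≡0 t≡0 eq zero    = trans (⊛-zero s d (d≡0 z<s)) (sym (t≡0 z<s))
⊛-delay (suc N) s d t d≡0 t≡0 eq (suc n) = trans (⊛-shift s d (d≡0 z<s) n)
  (⊛-delay N s (d ∘ suc) (t ∘ suc) (d≡0 ∘ s≤s) (t≡0 ∘ s≤s) eq n)

-- Determinants of Toeplitz-Hessenberg matrices.

det-cong : ∀ {n} {A A′ : Matrix n} → (∀ i j → A i j ≡ A′ i j) → det A ≡ det A′
det-cong {zero}  eq = refl
det-cong {suc n} eq = sum-cong-≗ λ j → cong₂ _*_
  (cong ((- 1ℚ) ^ toℕ j *_) (eq zero j))
  (det-cong λ i k → eq (suc i) (punchIn j k))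

-- The entry is `e (i ∸ j)` on and below the diagonal. Recursion along diagonals avoids truncated
-- subtraction and makes shift invariance definitional.
lowerToeplitz : Series → ℕ → ℕ → ℚ
lowerToeplitz e i       zero    = e i
lowerToeplitz e zero    (suc j) = 0ℚ
lowerToeplitz e (suc i) (suc j) = lowerToeplitz e i j

-- Deleting row 0 and column 1 shifts the first column and keeps the others, so
-- the expansion needs an arbitrary first column v; the Toeplitz matrix with
-- e 0 on the superdiagonal is the case v = e ∘ suc.
hessenberg : Series → Series → ∀ n → Matrix n
hessenberg e v n i zero    = v (toℕ i)
hessenberg e v n i (suc j) = lowerToeplitz e (toℕ i) (toℕ j)

module _ (e : Series) (e₀≡1 : e 0 ≡ 1ℚ) where

  toeplitzDet : ℕ → ℚ
  toeplitzDet n = det (hessenberg e (e ∘ suc) n)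

  -- Row 0 is `v 0`, `e 0 ≡ 1`, `0`, ..., so two minors survive: without column 0 the Toeplitz
  -- matrix remains, without column 1 the same shape with `v ∘ suc`. Size at least 2 ensures that
  -- column 1 exists.
  det-hessenberg-step : ∀ v n →
    det (hessenberg e v (suc (suc n))) ≡ v 0 * toeplitzDet (suc n) - det (hessenberg e (v ∘ suc) (suc n))
  det-hessenberg-step v n = begin
    1ℚ * v 0 * minor zero + ((- 1ℚ) ^ 1 * e 0 * minor (suc zero) + rest)
      ≡⟨ cong₂ (λ x y → 1ℚ * v 0 * x + ((- 1ℚ) ^ 1 * e 0 * y + rest))
           (det-cong minor₀) (det-cong minor₁) ⟩
    1ℚ * v 0 * D + ((- 1ℚ) ^ 1 * e 0 * D′ + rest)
      ≡⟨ cong₂ (λ x y → 1ℚ * v 0 * D + ((- 1ℚ) ^ 1 * x * D′ + y)) e₀≡1 rest≡0 ⟩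
    1ℚ * v 0 * D + ((- 1ℚ) ^ 1 * 1ℚ * D′ + 0ℚ)
      ≡⟨ solve 3 (λ x y z → con 1ℚ :* x :* y :+ (con (- 1ℚ) :* con 1ℚ :* z :+ con 0ℚ) := x :* y :+ :- z)
           refl (v 0) D D′ ⟩
    v 0 * D - D′ ∎
    where
    H = hessenberg e v (suc (suc n))

    minorMatrix : Fin (suc (suc n)) → Matrix (suc n)
    minorMatrix j i = removeAt (H (suc i)) j

    minor : Fin (suc (suc n)) → ℚ
    minor j = det (minorMatrix j)

    rest = sum λ (j : Fin n) →
      (- 1ℚ) ^ toℕ (suc (suc j)) * H zero (suc (suc j)) * minor (suc (suc j))

    D  = toeplitzDet (suc n)
    D′ = det (hessenberg e (v ∘ suc) (suc n))

    minor₀ : ∀ i j → minorMatrix zero i j ≡ hessenberg e (e ∘ suc) (suc n) i j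
    minor₀ i zero    = refl
    minor₀ i (suc j) = refl

    minor₁ : ∀ i j → minorMatrix (suc zero) i j ≡ hessenberg e (v ∘ suc) (suc n) i j
    minor₁ i zero    = refl
    minor₁ i (suc j) = refl

    rest≡0 : rest ≡ 0ℚ
    rest≡0 = trans
      (sum-cong-≗ λ j → solve 2 (λ x y → x :* con 0ℚ :* y := con 0ℚ) refl
        ((- 1ℚ) ^ toℕ (suc (suc j))) (minor (suc (suc j))))
      (sum-replicate-zero n)

  signedDet : Series
  signedDet n = (- 1ℚ) ^ n * toeplitzDet n

  -- Each expansion step splits off the first term of the Cauchy product and replaces `v` by its
  -- tail, so the induction has to range over all `v`.
  ⊛-signedDet : ∀ v n → (v ⊛ signedDet) n ≡ (- 1ℚ) ^ n * det (hessenberg e v (suc n))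
  ⊛-signedDet v zero    =
    solve 1 (λ x → x :* con 1ℚ :+ con 0ℚ := con 1ℚ :* (con 1ℚ :* x :* con 1ℚ :+ con 0ℚ)) refl (v 0)
  ⊛-signedDet v (suc n) = begin
    v 0 * (- 1ℚ * s * D) + ((v ∘ suc) ⊛ signedDet) n
      ≡⟨ cong (_+_ (v 0 * (- 1ℚ * s * D))) (⊛-signedDet (v ∘ suc) n) ⟩
    v 0 * (- 1ℚ * s * D) + s * D′
      ≡⟨ solve 4 (λ x s y z → x :* (con (- 1ℚ) :* s :* y) :+ s :* z
                            := con (- 1ℚ) :* s :* (x :* y :+ :- z)) refl (v 0) s D D′ ⟩
    - 1ℚ * s * (v 0 * D - D′)
      ≡⟨ cong (- 1ℚ * s *_) (det-hessenberg-step v n) ⟨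
    - 1ℚ * s * det (hessenberg e v (suc (suc n))) ∎
    where
    s  = (- 1ℚ) ^ n
    D  = toeplitzDet (suc n)
    D′ = det (hessenberg e (v ∘ suc) (suc n))

  -- For `v = e ∘ suc` the determinant in `⊛-signedDet` is `toeplitzDet (suc n)` itself, and it
  -- cancels the leading term, which has the opposite sign.
  signedDet-inverse : e ⊛ signedDet ≗ monomial 1ℚ 0
  signedDet-inverse zero    = cong (λ x → x * 1ℚ + 0ℚ) e₀≡1
  signedDet-inverse (suc n) = begin
    e 0 * (- 1ℚ * s * D) + ((e ∘ suc) ⊛ signedDet) n
      ≡⟨ cong₂ (λ x y → x * (- 1ℚ * s * D) + y) e₀≡1 (⊛-signedDet (e ∘ suc) n) ⟩
    1ℚ * (- 1ℚ * s * D) + s * D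
      ≡⟨ solve 2 (λ s y → con 1ℚ :* (con (- 1ℚ) :* s :* y) :+ s :* y := con 0ℚ) refl s D ⟩
    0ℚ ∎
    where
    s = (- 1ℚ) ^ n
    D = toeplitzDet (suc n)

-- The case `e k = N! / (N + k)!`.

module _ (N : ℕ) where

  !/+! : Series
  !/+! k = (+ (N !) / ((N ℕ.+ k) !)) {{(N ℕ.+ k) !≢0}}

  !/!-cong : ∀ {m n} → m ≡ n → (+ (N !) / (m !)) {{m !≢0}} ≡ (+ (N !) / (n !)) {{n !≢0}}
  !/!-cong refl = refl

  !/+!-0 : !/+! 0 ≡ 1ℚ
  !/+!-0 = trans (!/!-cong (ℕₚ.+-identityʳ N)) (n/n≡1 (N !) {{N !≢0}})

  invFact-+ : ∀ k → invFact (N ℕ.+ k) ≡ invFact N * !/+! k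
  invFact-+ k = begin
    i′                                 ≡⟨ ℚₚ.*-identityˡ i′ ⟨
    1ℚ * i′                            ≡⟨ cong (_* i′) (!*invFact≡1 N) ⟨
    fromℕℚ (N !) * invFact N * i′      ≡⟨ cong (_* i′) (ℚₚ.*-comm (fromℕℚ (N !)) (invFact N)) ⟩
    invFact N * fromℕℚ (N !) * i′      ≡⟨ ℚₚ.*-assoc (invFact N) (fromℕℚ (N !)) i′ ⟩
    invFact N * (fromℕℚ (N !) * i′)    ≡⟨ cong (invFact N *_) (/≡*-1/ (N !) ((N ℕ.+ k) !) {{(N ℕ.+ k) !≢0}}) ⟨
    invFact N * !/+! k                 ∎
    where i′ = invFact (N ℕ.+ k)

  c-suc : ∀ i j → c N (suc i) (suc j) ≡ c N i j
  -- `suc j ≤ᵇ suc i` unfolds to `j <ᵇ suc i`, which is stuck until `j` is split.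
  c-suc i zero = !/!-cong (cong (λ m → m ∸ 1 ℕ.+ 1) (ℕₚ.+-suc N i))
  c-suc i (suc j) =
    cong (λ z → if suc j ≤ᵇ i then z else if suc j ≡ᵇ i ℕ.+ 1 then 1ℚ else 0ℚ)
      (!/!-cong (cong (λ m → m ∸ suc (suc j) ℕ.+ 1) (ℕₚ.+-suc N i)))

  -- The superdiagonal entry 1 is `!/+! 0`, hence the row offset `suc i`. Descending a diagonal
  -- reaches index 0, outside the matrix, where the formula for `c` still fits the pattern.
  c≡lowerToeplitz : ∀ i j → c N i j ≡ lowerToeplitz !/+! (suc i) j
  c≡lowerToeplitz i       zero          = !/!-cong (begin
    N ℕ.+ i ℕ.+ 1   ≡⟨ ℕₚ.+-assoc N i 1 ⟩
    N ℕ.+ (i ℕ.+ 1) ≡⟨ cong (N ℕ.+_) (ℕₚ.+-comm i 1) ⟩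
    N ℕ.+ suc i     ∎)
  c≡lowerToeplitz zero    (suc zero)    = sym !/+!-0
  c≡lowerToeplitz zero    (suc (suc j)) = refl
  c≡lowerToeplitz (suc i) (suc j)       = trans (c-suc i j) (c≡lowerToeplitz i j)

  det-cMatrix : ∀ n → det (cMatrix N n) ≡ toeplitzDet !/+! !/+!-0 n
  det-cMatrix n = det-cong entry
    where
    entry : ∀ i j → cMatrix N n i j ≡ hessenberg !/+! (!/+! ∘ suc) n i j
    entry i zero    = c≡lowerToeplitz (suc (toℕ i)) 1
    entry i (suc j) = c≡lowerToeplitz (suc (toℕ i)) (suc (suc (toℕ j)))

  denominator-< : ∀ {n} → n < N → (exp ⊖ expPartial N) n ≡ 0ℚ
  denominator-< {n} n<N =
    trans (cong (λ z → invFact n - z) (monomials-< invFact n<N)) (ℚₚ.+-inverseʳ (invFact n))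

  denominator-+ : ∀ k → (exp ⊖ expPartial N) (N ℕ.+ k) ≡ invFact N * !/+! k
  denominator-+ k = begin
    invFact (N ℕ.+ k) - expPartial N (N ℕ.+ k)
      ≡⟨ cong (λ z → invFact (N ℕ.+ k) - z) (monomials-≥ invFact N (ℕₚ.m≤m+n N k)) ⟩
    invFact (N ℕ.+ k) - 0ℚ
      ≡⟨ ℚₚ.+-identityʳ _ ⟩
    invFact (N ℕ.+ k)
      ≡⟨ invFact-+ k ⟩
    invFact N * !/+! k ∎

  determinantFormula : ℕ → ℚ
  determinantFormula n = (- 1ℚ) ^ n * fromℕℚ (n !) * det (cMatrix N n)

  determinantFormula-isHypergeometricBernoulli : IsHypergeometricBernoulli N determinantFormula
  determinantFormula-isHypergeometricBernoulli n = trans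
    (⊛-cong {egf determinantFormula} {p} {exp ⊖ expPartial N} egf≗ (λ _ → refl) n)
    -- Denominator and right-hand side both vanish below degree `N`, so only the coefficients from
    -- `N` on are left to compare.
    (⊛-delay N p (exp ⊖ expPartial N) (monomial (invFact N) N)
      denominator-< (λ n<N → monomial-≢ (invFact N) (ℕₚ.<⇒≢ n<N)) delayed n)
    where
    p = signedDet !/+! !/+!-0

    egf≗ : egf determinantFormula ≗ p
    egf≗ m = begin
      s * f * det (cMatrix N m) * invFact m
        ≡⟨ solve 4 (λ s f d i → s :* f :* d :* i := s :* d :* (f :* i)) refl s f (det (cMatrix N m)) (invFact m) ⟩
      s * det (cMatrix N m) * (f * invFact m)
        ≡⟨ cong₂ (λ x y → s * x * y) (det-cMatrix m) (!*invFact≡1 m) ⟩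
      p m * 1ℚ
        ≡⟨ ℚₚ.*-identityʳ (p m) ⟩
      p m ∎
      where
      s = (- 1ℚ) ^ m
      f = fromℕℚ (m !)

    -- The coefficient `a` is kept apart from the degree `M`, since `invFact N` would change along
    -- an induction on `N`.
    monomial-+ : ∀ a M k → a * monomial 1ℚ 0 k ≡ monomial a M (M ℕ.+ k)
    monomial-+ a zero    zero    = ℚₚ.*-identityʳ a
    monomial-+ a zero    (suc k) = ℚₚ.*-zeroʳ a
    monomial-+ a (suc M) k       = monomial-+ a M k

    delayed : p ⊛ ((exp ⊖ expPartial N) ∘ (N ℕ.+_)) ≗ monomial (invFact N) N ∘ (N ℕ.+_)
    delayed k = begin
      (p ⊛ ((exp ⊖ expPartial N) ∘ (N ℕ.+_))) k ≡⟨ ⊛-cong {p} (λ _ → refl) denominator-+ k ⟩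
      (p ⊛ λ m → invFact N * !/+! m) k          ≡⟨ ⊛-scaleʳ (invFact N) p !/+! k ⟩
      invFact N * (p ⊛ !/+!) k                  ≡⟨ cong (invFact N *_) (⊛-comm p !/+! k) ⟩
      invFact N * (!/+! ⊛ p) k                  ≡⟨ cong (invFact N *_) (signedDet-inverse !/+! !/+!-0 k) ⟩
      invFact N * monomial 1ℚ 0 k               ≡⟨ monomial-+ (invFact N) N k ⟩
      monomial (invFact N) N (N ℕ.+ k)          ∎

theorem1 : (N n : ℕ) → 1 ≤ N → 1 ≤ n →
    (B : ℕ → ℚ) → IsHypergeometricBernoulli N B →
    B n ≡ (- 1ℚ) ^ n * fromℕℚ (n !) * det (cMatrix N n)
theorem1 N n _ _ B isB =
  hypergeometricBernoulli-unique N {B} {determinantFormula N} isB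
    (determinantFormula-isHypergeometricBernoulli N) n
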